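{- Let $A,B\subseteq\Sigma^+$ (not necessarily finite) and $k\ge1$. The term $\langle A,B\rangle$ has a deduction tree of size $k$ if and only if there is a formula $\phi\in\mathrm{LTL}[\mathsf{X},\mathsf{wX},\mathsf{F},\mathsf{G}]$ separating $A$ from $B$ with $\mathrm{size}(\phi)=k$.
   Context: Let $AP$ be a finite set of atomic propositions and $\Sigma=2^{AP}$. Formulae of $\mathrm{LTL}[\mathsf{X},\mathsf{wX},\mathsf{F},\mathsf{G}]$ are generated by $\phi::=p\mid\neg p\mid\phi\lor\phi\mid\phi\land\phi\mid\mathsf{X}\phi\mid\mathsf{wX}\phi\mid\mathsf{F}\phi\mid\mathsf{G}\phi$ ($p\in AP$), interpreted on $\sigma\in\Sigma^+$ at positions $0\le i<|\sigma|$: literals/Booleans as usual; $\mathsf{X}\phi$: $i+1<|\sigma|$ and $\phi$ at $i+1$; $\mathsf{wX}\phi$: $i+1=|\sigma|$ or $\phi$ at $i+1$; $\mathsf{F}\phi$/$\mathsf{G}\phi$: $\phi$ at some/every $j$ with $i\le j<|\sigma|$. Size: literals 1, unary operators add 1, binary connectives sum sizes plus 1. For $C\subseteq\Sigma^+$, write $C\models\phi$ if $\sigma,0\models\phi$ for all $\sigma\in C$ and $C\perp\phi$ if $\sigma,0\not\models\phi$ for all $\sigma\in C$; $\phi$ separates $A$ from $B$ if $A\models\phi$ and $B\perp\phi$. Notation: for $\sigma=w_0\cdots w_m$ and $j\le m$, $\sigma^{(j)}=w_j\cdots w_m$; $A^{\mathsf X}=\{\sigma^{(1)}:\sigma\in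 A,|\sigma|\ge2\}$; $A^{\mathsf G}=\{\sigma^{(j)}:\sigma\in A, 0\le j<|\sigma|\}$; a future point for $A$ is a map $f:A\to\mathbb N$ with $f(\sigma)<|\sigma|$ for all $\sigma\in A$, and then $A^f=\{\sigma^{(f(\sigma))}:\sigma\in A\}$. Proof system: terms are pairs $\langle A,B\rangle$ with $A,B\subseteq\Sigma^+$; the rules (conclusion from hypotheses) are: Atomic: $\langle A,B\rangle$ with no hypotheses, provided $A\models\alpha$ and $B\perp\alpha$ for some literal $\alpha$; Or: $\langle A_1\uplus A_2,B\rangle$ from $\langle A_1,B\rangle$ and $\langle A_2,B\rangle$ ($\uplus$ = union of disjoint sets); And: $\langle A,B_1\uplus B_2\rangle$ from $\langle A,B_1\rangle$ and $\langle A,B_2\rangle$; Next: $\langle A,B\rangle$ from $\langle A^{\mathsf X},B^{\mathsf X}\rangle$ provided $|A^{\mathsf X}|=|A|$; WeakNext: $\langle A,B\rangle$ from $\langle A^{\mathsf X},B^{\mathsf X}\rangle$ provided $|B^{\mathsf X}|=|B|$; Future: $\langle A,B\rangle$ from $\langle A^f,B^{\mathsf G}\rangle$ for some future point $f$ for $A$; Globally: $\langle A,B\rangle$ from $\langle A^{\mathsf G},B^f\rangle$ for some future point $f$ for $B$. A deduction tree for $\langle A,B\rangle$ is a finite tree of rule applications with root conclusion $\langle A,B\rangle$, in which every hypothesis is the conclusion of a rule application (so all branches end in Atomic); its size is the number of rule applications in it.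
   Formalization: The side conditions |A^X|=|A| (Next) and |B^X|=|B| (WeakNext) are read as "every trace of A (resp. B) has length at least 2"; with cardinalities of sets the claim fails, e.g. A={pp,∅p}, B={p,∅}, k=2, where X p separates but no tree of size 2 exists. -}

module Defs where

open import Data.Fin.Base using (Fin; zero; toℕ; fromℕ<) renaming (_≤_ to _≤ᶠ_)
open import Data.Fin.Subset using (Subset) renaming (_∈_ to _∈ˢ_; _∉_ to _∉ˢ_)
import Data.List.Base as List
open import Data.List.NonEmpty using (List⁺; length; toList; drop+)
open import Data.Nat.Base using (ℕ; suc; _+_; _≤_; _<_)
open import Data.Product using (Σ-syntax; ∃-syntax; _×_)
open import Data.Sum using (_⊎_)
open import Level using (Level) renaming (suc to lsuc)
open import Relation.Binary.PropositionalEquality using (_≡_)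
open import Relation.Nullary using (¬_)
open import Relation.Unary using (Pred; _∈_; _⊆_; _≐_; _∪_) renaming (_⊥_ to Disjoint)

private
  variable
    n : ℕ
    ℓ : Level

-- AP = Fin n and Σ = 2^AP = Subset n.
Trace : ℕ → Set
Trace n = List⁺ (Subset n)

Position : Trace n → Set
Position σ = Fin (length σ)

data Literal (n : ℕ) : Set where
  pos neg : Fin n → Literal n

data Formula (n : ℕ) : Set where
  lit     : Literal n → Formula n
  _∨_ _∧_ : Formula n → Formula n → Formula n
  X wX    : Formula n → Formula n
  F G     : Formula n → Formula n

size : Formula n → ℕ
size (lit α) = 1
size (φ ∨ ψ) = size φ + size ψ + 1
size (φ ∧ ψ) = size φ + size ψ + 1
size (X φ)   = size φ + 1
size (wX φ)  = size φ + 1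
size (F φ)   = size φ + 1
size (G φ)   = size φ + 1

infix 4 _[_]⊨_ _⊨_ _⊥_

_[_]⊨_ : (σ : Trace n) → Position σ → Formula n → Set
σ [ i ]⊨ lit (pos p) = p ∈ˢ List.lookup (toList σ) i
σ [ i ]⊨ lit (neg p) = p ∉ˢ List.lookup (toList σ) i
σ [ i ]⊨ φ ∨ ψ       = (σ [ i ]⊨ φ) ⊎ (σ [ i ]⊨ ψ)
σ [ i ]⊨ φ ∧ ψ       = (σ [ i ]⊨ φ) × (σ [ i ]⊨ ψ)
σ [ i ]⊨ X φ         = Σ[ i+1<∣σ∣ ∈ suc (toℕ i) < length σ ] (σ [ fromℕ< i+1<∣σ∣ ]⊨ φ)
σ [ i ]⊨ wX φ        = (suc (toℕ i) ≡ length σ)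
                       ⊎ (Σ[ i+1<∣σ∣ ∈ suc (toℕ i) < length σ ] (σ [ fromℕ< i+1<∣σ∣ ]⊨ φ))
σ [ i ]⊨ F φ         = ∃[ j ] (i ≤ᶠ j × (σ [ j ]⊨ φ))
σ [ i ]⊨ G φ         = ∀ j → i ≤ᶠ j → σ [ j ]⊨ φ

_⊨_ : Pred (Trace n) ℓ → Formula n → Set ℓ
C ⊨ φ = ∀ σ → σ ∈ C → σ [ zero ]⊨ φ

_⊥_ : Pred (Trace n) ℓ → Formula n → Set ℓ
C ⊥ φ = ∀ σ → σ ∈ C → ¬ (σ [ zero ]⊨ φ)

Separates : Formula n → Pred (Trace n) ℓ → Pred (Trace n) ℓ → Set ℓ
Separates φ A B = (A ⊨ φ) × (B ⊥ φ)

-- drop+ truncates at the last letter, which a Position never reaches past.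
suffix : (σ : Trace n) → Position σ → Trace n
suffix σ j = drop+ (toℕ j) σ

_^X : Pred (Trace n) ℓ → Pred (Trace n) ℓ
(A ^X) τ = ∃[ σ ] (σ ∈ A × (Σ[ 1<∣σ∣ ∈ 1 < length σ ] (τ ≡ suffix σ (fromℕ< 1<∣σ∣))))

_^G : Pred (Trace n) ℓ → Pred (Trace n) ℓ
(A ^G) τ = ∃[ σ ] (σ ∈ A × (∃[ j ] (τ ≡ suffix σ j)))

-- The irrelevant argument makes the value depend on the trace only, not on
-- the proof of its membership in A, so that this is a map on the set A.
FuturePoint : Pred (Trace n) ℓ → Set ℓ
FuturePoint A = ∀ σ → .(σ ∈ A) → Position σ

_^[_] : (A : Pred (Trace n) ℓ) → FuturePoint A → Pred (Trace n) ℓ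
(A ^[ f ]) τ = ∃[ σ ] (Σ[ σ∈A ∈ σ ∈ A ] (τ ≡ suffix σ (f σ σ∈A)))

-- Sets of traces are predicates, whose equality is extensional (_≐_).
_≐_⊎ᵈ_ : Pred (Trace n) ℓ → Pred (Trace n) ℓ → Pred (Trace n) ℓ → Set ℓ
A ≐ A₁ ⊎ᵈ A₂ = (A ≐ (A₁ ∪ A₂)) × Disjoint A₁ A₂

-- The side condition |A^X| = |A|, where |A^X| counts one successor for each
-- trace of A that has one: no trace of A is lost in passing to A^X.
-- Comparing the cardinalities of the underlying sets instead would break the
-- correspondence with formulae, even for finite sets.  Over AP = {p},
-- * X p separates A = {pp, ∅p} from B = {p, ∅}, but A^X = {p} is smaller
--   than A, and no other rule gives a tree of size 2;
-- * if A is {p} plus all traces with p at position 1, and B is {∅} plus all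
--   traces of length ≥ 2 without p at position 1, then A^X and A are both
--   countably infinite and p separates A^X from B^X, but no formula of size 2
--   separates A from B.
AllHaveNext : Pred (Trace n) ℓ → Set ℓ
AllHaveNext A = A ⊆ (λ σ → 2 ≤ length σ)

data Deduction {n : ℕ} {ℓ : Level} : (A B : Pred (Trace n) ℓ) → Set (lsuc ℓ) where
  atomic   : ∀ {A B} (α : Literal n) → A ⊨ lit α → B ⊥ lit α → Deduction A B
  or       : ∀ {A A₁ A₂ B} → A ≐ A₁ ⊎ᵈ A₂ → Deduction A₁ B → Deduction A₂ B → Deduction A B
  and      : ∀ {A B B₁ B₂} → B ≐ B₁ ⊎ᵈ B₂ → Deduction A B₁ → Deduction A B₂ → Deduction A B
  next     : ∀ {A B} → AllHaveNext A → Deduction (A ^X) (B ^X) → Deduction A B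
  weakNext : ∀ {A B} → AllHaveNext B → Deduction (A ^X) (B ^X) → Deduction A B
  future   : ∀ {A B} (f : FuturePoint A) → Deduction (A ^[ f ]) (B ^G) → Deduction A B
  globally : ∀ {A B} (f : FuturePoint B) → Deduction (A ^G) (B ^[ f ]) → Deduction A B

treeSize : {A B : Pred (Trace n) ℓ} → Deduction A B → ℕ
treeSize (atomic _ _ _) = 1
treeSize (or _ s t)     = treeSize s + treeSize t + 1
treeSize (and _ s t)    = treeSize s + treeSize t + 1
treeSize (next _ t)     = treeSize t + 1
treeSize (weakNext _ t) = treeSize t + 1
treeSize (future _ t)   = treeSize t + 1
treeSize (globally _ t) = treeSize t + 1

{-# OPTIONS --safe #-}
-- The rules mirror the connectives, and a suffix of σ satisfies a formula iff
-- σ satisfies it at the position where the suffix starts, so a deduction tree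
-- is read off as a formula of the same size.  Conversely, satisfaction on a
-- finite trace is decidable: for a disjunction this splits A into the traces
-- that satisfy the first disjunct and the others (dually for conjunctions and
-- B), and for F and G it lets a future point be found by search.
module Submission where

open import Data.Fin.Base using (Fin; zero; suc; toℕ; fromℕ<)
import Data.Fin.Properties as Fin
open import Data.Fin.Subset.Properties using (_∈?_)
open import Data.List.Base as List using (List)
open import Data.List.NonEmpty using (_∷_; length)
open import Data.Nat.Base using (ℕ; suc; _+_; _<_; _≥_; s≤s; z≤n)
import Data.Nat.Properties as ℕ
open import Data.Product using (Σ-syntax; ∃; _×_; _,_; proj₁; proj₂)
open import Data.Product.Function.NonDependent.Propositional using (_×-⇔_)
open import Data.Sum using (_⊎_; inj₁; inj₂; [_,_]′)
open import Data.Sum.Function.Propositional using (_⊎-⇔_)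
open import Function.Base using (_∘_)
open import Function.Bundles using (_⇔_; mk⇔; Equivalence)
open import Function.Properties.Equivalence using () renaming (refl to ⇔-refl; trans to ⇔-trans; sym to ⇔-sym)
open import Level using (Level)
open import Relation.Binary.PropositionalEquality using (_≡_; refl; trans; cong; cong₂)
open import Relation.Nullary using (yes; no; contradiction)
open import Relation.Nullary.Decidable using (map′; ¬?; _×-dec_; _⊎-dec_; _→-dec_; decidable-stable)
open import Relation.Unary using (Pred; Decidable; _∈_; _∩_; ∁)
open import Defs

open Equivalence using (to; from)

private
  variable
    n : ℕ
    ℓ : Level

-- No operator looks to the left of the current position, so prepending a letter only shifts
-- positions by one. The `X` case stands apart because it recurs as the second disjunct of `wX`.
⊨-tail : ∀ {x y} {ys : List _} (φ : Formula n) i →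
  (x ∷ y List.∷ ys) [ suc i ]⊨ φ ⇔ (y ∷ ys) [ i ]⊨ φ
⊨-tail-X : ∀ {x y} {ys : List _} (φ : Formula n) i →
  (x ∷ y List.∷ ys) [ suc i ]⊨ X φ ⇔ (y ∷ ys) [ i ]⊨ X φ

⊨-tail-X φ i = mk⇔
  (λ { (s≤s p , s) → p , to (⊨-tail φ (fromℕ< p)) s })
  (λ { (p , s) → s≤s p , from (⊨-tail φ (fromℕ< p)) s })

⊨-tail (lit (pos p)) i = ⇔-refl
⊨-tail (lit (neg p)) i = ⇔-refl
⊨-tail (φ ∨ ψ) i = ⊨-tail φ i ⊎-⇔ ⊨-tail ψ i
⊨-tail (φ ∧ ψ) i = ⊨-tail φ i ×-⇔ ⊨-tail ψ i
⊨-tail (X φ) i = ⊨-tail-X φ i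
⊨-tail (wX φ) i = mk⇔ ℕ.suc-injective (cong suc) ⊎-⇔ ⊨-tail-X φ i
⊨-tail (F φ) i = mk⇔
  -- A witness at or after `suc i` cannot be the dropped letter, so it has the form `suc j`.
  (λ { (suc j , s≤s i≤j , s) → j , i≤j , to (⊨-tail φ j) s })
  (λ { (j , i≤j , s) → suc j , s≤s i≤j , from (⊨-tail φ j) s })
⊨-tail (G φ) i = mk⇔
  (λ s j i≤j → to (⊨-tail φ j) (s (suc j) (s≤s i≤j)))
  (λ { s (suc j) (s≤s i≤j) → from (⊨-tail φ j) (s j i≤j) })

⊨-suffix : (φ : Formula n) (σ : Trace n) (j : Position σ) →
  suffix σ j [ zero ]⊨ φ ⇔ σ [ j ]⊨ φ
⊨-suffix φ σ zero = ⇔-refl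
-- A position `suc j` forces a second letter, so the first one can be peeled off.
⊨-suffix φ (x ∷ y List.∷ ys) (suc j) =
  ⇔-trans (⊨-suffix φ (y ∷ ys) j) (⇔-sym (⊨-tail φ j))

⊨-dec : (φ : Formula n) (σ : Trace n) → Decidable (λ i → σ [ i ]⊨ φ)
⊨-dec-X : (φ : Formula n) (σ : Trace n) → Decidable (λ i → σ [ i ]⊨ X φ)

⊨-dec-X φ σ i with suc (toℕ i) ℕ.<? length σ
... | yes p = map′ (p ,_) proj₂ (⊨-dec φ σ (fromℕ< p))
... | no ¬p = no (¬p ∘ proj₁)

⊨-dec (lit (pos p)) σ i = p ∈? _
⊨-dec (lit (neg p)) σ i = ¬? (p ∈? _)
⊨-dec (φ ∨ ψ) σ i = ⊨-dec φ σ i ⊎-dec ⊨-dec ψ σ i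
⊨-dec (φ ∧ ψ) σ i = ⊨-dec φ σ i ×-dec ⊨-dec ψ σ i
⊨-dec (X φ) σ i = ⊨-dec-X φ σ i
⊨-dec (wX φ) σ i = (suc (toℕ i) ℕ.≟ length σ) ⊎-dec ⊨-dec-X φ σ i
⊨-dec (F φ) σ i = Fin.any? (λ j → (i Fin.≤? j) ×-dec ⊨-dec φ σ j)
⊨-dec (G φ) σ i = Fin.all? (λ j → (i Fin.≤? j) →-dec ⊨-dec φ σ j)

-- Defaults to zero when P is empty.
search : ∀ {m p} {P : Pred (Fin (suc m)) p} → Decidable P → Fin (suc m)
search P? with Fin.any? P?
... | yes (i , _) = i
... | no _        = zero

search-finds : ∀ {m p} {P : Pred (Fin (suc m)) p} (P? : Decidable P) → ∃ P → P (search P?)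
search-finds P? ∃P with Fin.any? P?
... | yes (_ , Pi) = Pi
... | no ¬∃P       = contradiction ∃P ¬∃P

-- Traces are nonempty. The first alternative is the side condition of `weakNext`, the second is the
-- end-of-trace disjunct of `wX` at position `zero`.
1<length⊎1≡length : (σ : Trace n) → 1 < length σ ⊎ 1 ≡ length σ
1<length⊎1≡length σ = ℕ.m≤n⇒m<n∨m≡n (s≤s z≤n)

-- The side condition of `next` supplies the successor that `X` demands on `A`, and that of
-- `weakNext` refutes the end-of-trace disjunct on `B`. A future point is a witness for `F` on `A`,
-- or a counterexample to `G` on `B`.
deduction⇒formula : {A B : Pred (Trace n) ℓ} (t : Deduction A B) →
  Σ[ φ ∈ Formula n ] (Separates φ A B × size φ ≡ treeSize t)
deduction⇒formula (atomic α A⊨ B⊥) = lit α , (A⊨ , B⊥) , refl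
deduction⇒formula (or ((A⊆ , _) , _) s t)
  with deduction⇒formula s | deduction⇒formula t
... | φ , (A₁⊨ , B⊥φ) , p | ψ , (A₂⊨ , B⊥ψ) , q =
  φ ∨ ψ ,
  ((λ σ σ∈A → [ inj₁ ∘ A₁⊨ σ , inj₂ ∘ A₂⊨ σ ]′ (A⊆ σ∈A)) ,
   (λ σ σ∈B → [ B⊥φ σ σ∈B , B⊥ψ σ σ∈B ]′)) ,
  cong (_+ 1) (cong₂ _+_ p q)
deduction⇒formula (and ((B⊆ , _) , _) s t)
  with deduction⇒formula s | deduction⇒formula t
... | φ , (A⊨φ , B₁⊥) , p | ψ , (A⊨ψ , B₂⊥) , q =
  φ ∧ ψ ,
  ((λ σ σ∈A → A⊨φ σ σ∈A , A⊨ψ σ σ∈A) ,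
   (λ σ σ∈B (u , v) → [ (λ σ∈B₁ → B₁⊥ σ σ∈B₁ u) , (λ σ∈B₂ → B₂⊥ σ σ∈B₂ v) ]′ (B⊆ σ∈B))) ,
  cong (_+ 1) (cong₂ _+_ p q)
deduction⇒formula (next A-next t) with deduction⇒formula t
... | φ , (AX⊨ , BX⊥) , p =
  X φ ,
  ((λ σ σ∈A → A-next σ∈A ,
      to (⊨-suffix φ σ _) (AX⊨ _ (σ , σ∈A , A-next σ∈A , refl))) ,
   (λ σ σ∈B (1<∣σ∣ , s) → BX⊥ _ (σ , σ∈B , 1<∣σ∣ , refl) (from (⊨-suffix φ σ _) s))) ,
  cong (_+ 1) p
deduction⇒formula (weakNext B-next t) with deduction⇒formula t
... | φ , (AX⊨ , BX⊥) , p =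
  wX φ ,
  ((λ σ σ∈A →
      [ (λ 1<∣σ∣ → inj₂ (1<∣σ∣ , to (⊨-suffix φ σ _) (AX⊨ _ (σ , σ∈A , 1<∣σ∣ , refl))))
      , inj₁ ]′ (1<length⊎1≡length σ)) ,
   (λ σ σ∈B →
      [ ℕ.<⇒≢ (B-next σ∈B)
      , (λ (1<∣σ∣ , s) → BX⊥ _ (σ , σ∈B , 1<∣σ∣ , refl) (from (⊨-suffix φ σ _) s)) ]′)) ,
  cong (_+ 1) p
deduction⇒formula (future f t) with deduction⇒formula t
... | φ , (Af⊨ , BG⊥) , p =
  F φ ,
  ((λ σ σ∈A → f σ σ∈A , z≤n , to (⊨-suffix φ σ _) (Af⊨ _ (σ , σ∈A , refl))) ,
   (λ σ σ∈B (j , _ , s) → BG⊥ _ (σ , σ∈B , j , refl) (from (⊨-suffix φ σ j) s))) ,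
  cong (_+ 1) p
deduction⇒formula (globally f t) with deduction⇒formula t
... | φ , (AG⊨ , Bf⊥) , p =
  G φ ,
  ((λ σ σ∈A j _ → to (⊨-suffix φ σ j) (AG⊨ _ (σ , σ∈A , j , refl))) ,
   (λ σ σ∈B s → Bf⊥ _ (σ , σ∈B , refl) (from (⊨-suffix φ σ _) (s (f σ σ∈B) z≤n)))) ,
  cong (_+ 1) p

-- With `P` at level zero both halves stay at level `ℓ`, the one level shared by all terms of a
-- `Deduction`.
split : {P : Pred (Trace n) Level.zero} → Decidable P → (A : Pred (Trace n) ℓ) →
  A ≐ (A ∩ P) ⊎ᵈ (A ∩ ∁ P)
split {P = P} P? A =
  (split⊆ , [ proj₁ , proj₁ ]′) , (λ ((_ , Pσ) , (_ , ¬Pσ)) → ¬Pσ Pσ)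
  where
  split⊆ : ∀ {σ} → σ ∈ A → (A ∩ P) σ ⊎ (A ∩ ∁ P) σ
  split⊆ {σ} σ∈A with P? σ
  ... | yes Pσ = inj₁ (σ∈A , Pσ)
  ... | no ¬Pσ = inj₂ (σ∈A , ¬Pσ)

formula⇒deduction : (φ : Formula n) {A B : Pred (Trace n) ℓ} → Separates φ A B →
  Σ[ t ∈ Deduction A B ] (treeSize t ≡ size φ)
formula⇒deduction (lit α) (A⊨ , B⊥) = atomic α A⊨ B⊥ , refl
formula⇒deduction (φ ∨ ψ) {A} (A⊨ , B⊥)
  with formula⇒deduction φ ((λ σ → proj₂) , (λ σ σ∈B → B⊥ σ σ∈B ∘ inj₁))
     | formula⇒deduction ψ
         ((λ σ (σ∈A , ¬s) → [ (λ s → contradiction s ¬s) , (λ s → s) ]′ (A⊨ σ σ∈A)) ,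
          (λ σ σ∈B → B⊥ σ σ∈B ∘ inj₂))
... | s , p | t , q =
  or (split (λ σ → ⊨-dec φ σ zero) A) s t , cong (_+ 1) (cong₂ _+_ p q)
formula⇒deduction (φ ∧ ψ) {B = B} (A⊨ , B⊥)
  with formula⇒deduction φ ((λ σ → proj₁ ∘ A⊨ σ) , (λ σ → proj₂))
     | formula⇒deduction ψ
         ((λ σ → proj₂ ∘ A⊨ σ) ,
          -- `B` is split by failure of `φ`, so its second half carries a double negation, which
          -- decidability removes.
          (λ σ (σ∈B , ¬¬u) v → B⊥ σ σ∈B (decidable-stable (⊨-dec φ σ zero) ¬¬u , v)))
... | s , p | t , q =
  and (split (λ σ → ¬? (⊨-dec φ σ zero)) B) s t , cong (_+ 1) (cong₂ _+_ p q)
formula⇒deduction (X φ) (A⊨ , B⊥)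
  with formula⇒deduction φ
         -- The position `fromℕ< 1<∣σ∣` is the same for every proof of the bound, so the one inside
         -- `A⊨` serves.
         ((λ { _ (σ , σ∈A , 1<∣σ∣ , refl) → from (⊨-suffix φ σ _) (proj₂ (A⊨ σ σ∈A)) }) ,
          (λ { _ (σ , σ∈B , 1<∣σ∣ , refl) s → B⊥ σ σ∈B (1<∣σ∣ , to (⊨-suffix φ σ _) s) }))
... | t , p = next (λ {σ} → proj₁ ∘ A⊨ σ) t , cong (_+ 1) p
formula⇒deduction (wX φ) (A⊨ , B⊥)
  with formula⇒deduction φ
         ((λ { _ (σ , σ∈A , 1<∣σ∣ , refl) → from (⊨-suffix φ σ (fromℕ< 1<∣σ∣))
                 ([ (λ 1≡∣σ∣ → contradiction 1≡∣σ∣ (ℕ.<⇒≢ 1<∣σ∣)) , proj₂ ]′ (A⊨ σ σ∈A)) }) ,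
          (λ { _ (σ , σ∈B , 1<∣σ∣ , refl) s →
                 B⊥ σ σ∈B (inj₂ (1<∣σ∣ , to (⊨-suffix φ σ _) s)) }))
... | t , p =
  weakNext
    -- A one-letter trace in `B` would satisfy `wX φ` outright.
    (λ {σ} σ∈B → [ (λ 1<∣σ∣ → 1<∣σ∣) , (λ 1≡∣σ∣ → contradiction (inj₁ 1≡∣σ∣) (B⊥ σ σ∈B)) ]′
                   (1<length⊎1≡length σ))
    t ,
  cong (_+ 1) p
formula⇒deduction (F φ) (A⊨ , B⊥)
  with formula⇒deduction φ
         ((λ { _ (σ , σ∈A , refl) → from (⊨-suffix φ σ _)
                 (search-finds (⊨-dec φ σ) (let (j , _ , s) = A⊨ σ σ∈A in j , s)) }) ,
          (λ { _ (σ , σ∈B , j , refl) s → B⊥ σ σ∈B (j , z≤n , to (⊨-suffix φ σ j) s) }))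
-- A future point may not inspect the membership proof, so the witness in `A⊨` cannot be its value.
-- The search depends on `σ` alone.
... | t , p = future (λ σ _ → search (⊨-dec φ σ)) t , cong (_+ 1) p
formula⇒deduction (G φ) (A⊨ , B⊥)
  with formula⇒deduction φ
         ((λ { _ (σ , σ∈A , j , refl) → from (⊨-suffix φ σ j) (A⊨ σ σ∈A j z≤n) }) ,
          (λ { _ (σ , σ∈B , refl) s →
                 -- Over finitely many positions, a decidable property that fails to hold everywhere
                 -- has a counterexample.
                 search-finds (λ i → ¬? (⊨-dec φ σ i))
                   (Fin.¬∀⟶∃¬ _ _ (⊨-dec φ σ) (λ ∀s → B⊥ σ σ∈B (λ j _ → ∀s j)))
                   (to (⊨-suffix φ σ _) s) }))
... | t , p = globally (λ σ _ → search (λ i → ¬? (⊨-dec φ σ i))) t , cong (_+ 1) p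

theorem3 : ∀ (n : ℕ) {ℓ : Level} (A B : Pred (Trace n) ℓ) (k : ℕ) → k ≥ 1 →
    (Σ[ t ∈ Deduction A B ] (treeSize t ≡ k)) ⇔ (Σ[ φ ∈ Formula n ] (Separates φ A B × size φ ≡ k))
theorem3 n A B k _ = mk⇔
  (λ (t , ∣t∣≡k) → let (φ , sep , eq) = deduction⇒formula t in φ , sep , trans eq ∣t∣≡k)
  (λ (φ , sep , ∣φ∣≡k) → let (t , eq) = formula⇒deduction φ sep in t , trans eq ∣φ∣≡k)
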